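{- For every integer $n\ge 1$, $a_n$ equals one plus the number of integer triples $(x,y,z)$ with $y,z\ge1$ and $x\ge 0$ satisfying $$n=2xyz+yz+x+y.$$ Moreover, $$a_n=1+\sum_{0\le j<n}D_{2j+1}(n-j).$$
   Context: For an integer $n\ge1$, $a_n$ denotes the number of integers $x$ with $0\le x\le n-1$ for which there exists a positive integer $h$ with $h\mid x$ and $(2x+1)\mid(2n-2h+1)$ (every positive integer divides $0$). For positive integers $m,N$, $D_m(N)$ denotes the number of positive divisors $d>1$ of $N$ with $d\equiv 1\pmod m$. -}

module Defs where

open import Data.Integer.Base as ℤ using (ℤ; +_)
open import Data.Integer.Divisibility.Signed using (divides)
  renaming (_∣_ to _∣ℤ_; _∣?_ to _∣ℤ?_)
open import Data.Integer.Properties using (*-identityʳ)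
open import Data.List.Base using (List; filter; length; map; upTo)
open import Data.List.Membership.Propositional using (_∈_)
open import Data.List.Relation.Unary.Unique.Propositional using (Unique)
open import Data.Nat.Base using (ℕ; zero; suc; _+_; _*_; _≤_; _<_; s≤s; z≤n)
open import Data.Nat.Divisibility using (_∣_; _∣?_; _∣0; ∣⇒≤)
open import Data.Nat.ListAction using (sum)
open import Data.Nat.Properties using (_≤?_; _<?_; anyUpTo?)
open import Data.Product.Base using (Σ; ∃-syntax; _×_; _,_)
open import Function.Bundles using (_⇔_)
open import Relation.Binary.PropositionalEquality using (_≡_; sym)
open import Relation.Nullary.Decidable using (Dec; yes; map′; _×-dec_)

-- "There are exactly k elements satisfying P": the distinct elements of some
-- list of length k are exactly those satisfying P.
HasSize : {A : Set} → (A → Set) → ℕ → Set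
HasSize {A = A} P k =
  Σ (List A) λ xs → Unique xs × (∀ x → x ∈ xs ⇔ P x) × length xs ≡ k

-- The second divisibility is over ℤ because 2n − 2h + 1 can be negative
-- (h is unbounded when x = 0).
Witness : ℕ → ℕ → ℕ → Set
Witness n x h =
  1 ≤ h × h ∣ x × + (2 * x + 1) ∣ℤ (+ (2 * n) ℤ.- + (2 * h) ℤ.+ + 1)

Admissible : ℕ → ℕ → Set
Admissible n x = ∃[ h ] Witness n x h

witness? : ∀ n x h → Dec (Witness n x h)
witness? n x h = (1 ≤? h) ×-dec (h ∣? x) ×-dec (_ ∣ℤ? _)

admissible? : ∀ n x → Dec (Admissible n x)
admissible? n zero = yes (1 , s≤s z≤n , 1 ∣0 , 1∣ℤ _)
  where
  1∣ℤ : ∀ i → + 1 ∣ℤ i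
  1∣ℤ i = divides i (sym (*-identityʳ i))
admissible? n x@(suc _) =
  map′ (λ { (h , _ , w) → h , w })
       (λ { (h , w@(_ , h∣x , _)) → h , s≤s (∣⇒≤ h∣x) , w })
       (anyUpTo? (witness? n x) (suc x))

a : ℕ → ℕ
a n = length (filter (admissible? n) (upTo n))

DivisorOneMod : ℕ → ℕ → ℕ → Set
DivisorOneMod m N d = 1 < d × d ∣ N × + m ∣ℤ (+ d ℤ.- + 1)

divisorOneMod? : ∀ m N d → Dec (DivisorOneMod m N d)
divisorOneMod? m N d = (1 <? d) ×-dec (d ∣? N) ×-dec (_ ∣ℤ? _)

-- Meaningful only for N ≥ 1, where every divisor of N lies in {0, …, N}.
D : ℕ → ℕ → ℕ
D m N = length (filter (divisorOneMod? m N) (upTo (suc N)))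

Solution : ℕ → ℤ × ℤ × ℤ → Set
Solution n (x , y , z) =
  + 1 ℤ.≤ y × + 1 ℤ.≤ z × + 0 ℤ.≤ x ×
  + n ≡ + 2 ℤ.* x ℤ.* y ℤ.* z ℤ.+ y ℤ.* z ℤ.+ x ℤ.+ y

sumBelow : ℕ → (ℕ → ℕ) → ℕ
sumBelow n f = sum (map f (upTo n))

syntax sumBelow n (λ j → e) = Σ[ j < n ] e

{-# OPTIONS --safe #-}

-- For x > 0, an admissible x = h z has n − h = (2x + 1) q + x with q ≥ 0, i.e. (q, h, z) solves
-- the equation; conversely h ≤ x < 2x + 1 makes h the remainder of n − x modulo 2x + 1, so x
-- determines (q, h, z).  The same equation reads n − q = h (1 + (2q + 1) z), so the solutions with
-- first entry q correspond to the divisors d = 1 + (2q + 1) z > 1 of n − q.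
module Submission where

open import Data.Integer.Base as ℤ using (ℤ; +_; +≤+)
open import Data.Integer.Divisibility.Signed using (∣⇒∣ᵤ; ∣ᵤ⇒∣)
  renaming (_∣_ to _∣ℤ_)
import Data.Integer.Properties as ℤ
import Data.Integer.Tactic.RingSolver as ℤ-Ring
open import Data.List.Base using (List; []; _∷_; _++_; cartesianProduct; filter; length; map; upTo)
open import Data.List.Membership.Propositional using (_∈_)
open import Data.List.Membership.Propositional.Properties
  using (∈-map⁺; ∈-map⁻; ++-∈⇔; ∈-filter⁺; ∈-filter⁻; ∈-upTo⁺; ∈-upTo⁻;
         ∈-cartesianProduct⁺)
open import Data.List.Membership.Propositional.Properties.WithK using (unique∧set⇒bag)
open import Data.List.Properties using (length-++; length-map)
open import Data.List.Relation.Binary.BagAndSetEquality using (∼bag⇒↭)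
open import Data.List.Relation.Binary.Permutation.Propositional.Properties using (↭-length)
open import Data.List.Relation.Unary.All as All using (All; []; _∷_)
import Data.List.Relation.Unary.All.Properties as All
open import Data.List.Relation.Unary.AllPairs using ([]; _∷_)
open import Data.List.Relation.Unary.Any using (here; there)
open import Data.List.Relation.Unary.Unique.Propositional using (Unique)
open import Data.List.Relation.Unary.Unique.Propositional.Properties
  using (cartesianProduct⁺; filter⁺; upTo⁺; ++⁺)
open import Data.Nat.Base using (ℕ; zero; suc; _+_; _*_; _∸_; _≤_; _<_; s≤s; z≤n; NonZero; >-nonZero)
open import Data.Nat.Divisibility using (_∣_; divides; ∣⇒≤)
open import Data.Nat.DivMod using (_%_; [m+kn]%n≡m%n; m<n⇒m%n≡m)
open import Data.Nat.ListAction using (sum)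
open import Data.Nat.Properties
open import Data.Nat.Tactic.RingSolver using (solve-∀)
open import Data.Product.Base using (∃-syntax; _×_; _,_; proj₁; proj₂)
open import Data.Sum.Base using (_⊎_; inj₁; inj₂)
import Data.Sum.Function.Propositional as Sum
open import Function.Base using (_∘_)
open import Function.Bundles using (_⇔_; mk⇔; Equivalence)
open import Function.Construct.Composition using (_⇔-∘_)
open import Function.Construct.Symmetry using (⇔-sym)
open import Relation.Binary.PropositionalEquality
  using (_≡_; refl; sym; trans; cong; cong₂; subst; module ≡-Reasoning)
open import Relation.Nullary.Decidable using (_×-dec_)
open import Relation.Nullary.Negation using (¬_; contradiction)
open import Relation.Unary using (Decidable)
open import Defs

open Equivalence using (to; from)

private
  variable
    A B : Set
    P Q : A → Set
    k l : ℕ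

-- Cardinalities

-- Injectivity is relative to a predicate because `product` and `divisorPair` are injective on the
-- solutions for a fixed `n`, but not on all triples.
InjectiveOn : (A → Set) → (A → B) → Set
InjectiveOn P f = ∀ {x y} → P x → P y → f x ≡ f y → x ≡ y

Image : (A → B) → (A → Set) → B → Set
Image f P y = ∃[ x ] (P x × f x ≡ y)

HasSize-cong : (∀ x → P x ⇔ Q x) → HasSize P k → HasSize Q k
HasSize-cong P⇔Q (xs , xs! , xs⇔P , len) =
  xs , xs! , (λ x → P⇔Q x ⇔-∘ xs⇔P x) , len

-- Two duplicate-free lists with the same members are permutations of each other. Both counting
-- identities reduce to this.
HasSize-unique : HasSize P k → HasSize P l → k ≡ l
HasSize-unique (xs , xs! , xs⇔P , refl) (ys , ys! , ys⇔P , refl) =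
  ↭-length (∼bag⇒↭ (unique∧set⇒bag xs! ys! λ {x} → ⇔-sym (ys⇔P x) ⇔-∘ xs⇔P x))

map-injectiveOn⁺ : {f : A → B} → InjectiveOn P f →
                   ∀ {xs} → All P xs → Unique xs → Unique (map f xs)
map-injectiveOn⁺ inj []         []         = []
map-injectiveOn⁺ inj (px ∷ pxs) (x≢ ∷ xs!) =
  All.map⁺ (All.zipWith (λ (py , x≢y) → x≢y ∘ inj px py) (pxs , x≢)) ∷
  map-injectiveOn⁺ inj pxs xs!

HasSize-image : (f : A → B) → InjectiveOn P f → HasSize P k → HasSize (Image f P) k
HasSize-image {P = P} f inj (xs , xs! , xs⇔P , len) =
  map f xs ,
  map-injectiveOn⁺ {P = P} inj (All.tabulate λ {x} → to (xs⇔P x)) xs! ,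
  (λ y → mk⇔
    (λ y∈ → let (x , x∈ , y≡) = ∈-map⁻ f y∈ in x , to (xs⇔P x) x∈ , sym y≡)
    (λ { (x , px , refl) → ∈-map⁺ f (from (xs⇔P x) px) })) ,
  trans (length-map f xs) len

HasSize-⊎ : (∀ {x} → P x → ¬ Q x) → HasSize P k → HasSize Q l →
            HasSize (λ x → P x ⊎ Q x) (k + l)
HasSize-⊎ disj (xs , xs! , xs⇔P , refl) (ys , ys! , ys⇔Q , refl) =
  xs ++ ys ,
  ++⁺ xs! ys! (λ {x} (x∈xs , x∈ys) → disj (to (xs⇔P x) x∈xs) (to (ys⇔Q x) x∈ys)) ,
  (λ x → (xs⇔P x Sum.⊎-⇔ ys⇔Q x) ⇔-∘ ++-∈⇔) ,
  length-++ xs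

HasSize-singleton : (x : A) → HasSize (_≡ x) 1
HasSize-singleton x =
  x ∷ [] , [] ∷ [] , (λ y → mk⇔ (λ { (here y≡x) → y≡x ; (there ()) }) here) , refl

HasSize-filter : (P? : Decidable P) {xs : List A} → Unique xs →
                 HasSize (λ x → x ∈ xs × P x) (length (filter P? xs))
HasSize-filter P? {xs} xs! =
  filter P? xs , filter⁺ P? xs! ,
  (λ x → mk⇔ (∈-filter⁻ P?) (λ (x∈ , px) → ∈-filter⁺ P? x∈ px)) , refl

-- Induction on the list: the pairs over the head are a copy of `Q x`, and they are disjoint from
-- the pairs over the tail because the head does not recur there.
HasSize-Σ : {Q : A → B → Set} {f : A → ℕ} → (∀ x → HasSize (Q x) (f x)) →
            ∀ {xs} → Unique xs →
            HasSize (λ (x , y) → x ∈ xs × Q x y) (sum (map f xs))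
HasSize-Σ hs {[]} [] = [] , [] , (λ _ → mk⇔ (λ ()) (λ ())) , refl
HasSize-Σ {Q = Q} hs {x ∷ xs} (x≢ ∷ xs!) =
  HasSize-cong
    (λ _ → mk⇔ (λ { (inj₁ (y , q , refl)) → here refl , q
                  ; (inj₂ (x∈ , q)) → there x∈ , q })
               (λ { (here refl , q) → inj₁ (_ , q , refl)
                  ; (there x∈ , q) → inj₂ (x∈ , q) }))
    (HasSize-⊎ (λ { (y , q , refl) (x∈ , _) → All.lookup x≢ x∈ refl })
      (HasSize-image {P = Q x} (x ,_) (λ { _ _ refl → refl }) (hs x))
      (HasSize-Σ hs xs!))

-- Solutions in natural numbers

Solutionℕ : ℕ → ℕ × ℕ × ℕ → Set
Solutionℕ n (x , y , z) = 1 ≤ y × 1 ≤ z × n ≡ 2 * x * y * z + y * z + x + y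

solutionℕ? : ∀ n → Decidable (Solutionℕ n)
solutionℕ? n (x , y , z) = (1 ≤? y) ×-dec (1 ≤? z) ×-dec (_ ≟ _)

toℤ³ : ℕ × ℕ × ℕ → ℤ × ℤ × ℤ
toℤ³ (x , y , z) = + x , + y , + z

pos-equation : ∀ x y z →
  + (2 * x * y * z + y * z + x + y) ≡
  + 2 ℤ.* + x ℤ.* + y ℤ.* + z ℤ.+ + y ℤ.* + z ℤ.+ + x ℤ.+ + y
pos-equation x y z = cong (λ i → i ℤ.+ + x ℤ.+ + y) (cong₂ ℤ._+_
  (trans (ℤ.pos-* (2 * x * y) z) (cong (ℤ._* + z)
    (trans (ℤ.pos-* (2 * x) y) (cong (ℤ._* + y) (ℤ.pos-* 2 x)))))
  (ℤ.pos-* y z))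

Solution⇔ : ∀ n t → Image toℤ³ (Solutionℕ n) t ⇔ Solution n t
Solution⇔ n t = mk⇔
  (λ { ((x , y , z) , (1≤y , 1≤z , eq) , refl) →
         +≤+ 1≤y , +≤+ 1≤z , +≤+ z≤n , trans (cong +_ eq) (pos-equation x y z) })
  -- Matching on the three inequalities forces each integer coordinate to be a natural number.
  (λ { (+≤+ {n = y} 1≤y , +≤+ {n = z} 1≤z , +≤+ {n = x} _ , eq) →
         (x , y , z) ,
         (1≤y , 1≤z , ℤ.+-injective (trans eq (sym (pos-equation x y z)))) , refl })

module _ {n} x y z (sol : Solutionℕ n (x , y , z)) where

  private
    1≤y = proj₁ sol
    1≤z = proj₁ (proj₂ sol)
    eq  = proj₂ (proj₂ sol)

  Solutionℕ-yz<n : y * z < n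
  Solutionℕ-yz<n = begin-strict
    y * z                           <⟨ m<m+n (y * z) 1≤y ⟩
    y * z + y                       ≤⟨ m≤n+m _ (2 * x * y * z + x) ⟩
    2 * x * y * z + x + (y * z + y) ≡⟨ rearrange x y z ⟩
    2 * x * y * z + y * z + x + y   ≡⟨ eq ⟨
    n                               ∎
    where
    open ≤-Reasoning
    rearrange : ∀ x y z → 2 * x * y * z + x + (y * z + y) ≡ 2 * x * y * z + y * z + x + y
    rearrange = solve-∀

  Solutionℕ-x+y≤n : x + y ≤ n
  Solutionℕ-x+y≤n = begin
    x + y                           ≤⟨ m≤n+m (x + y) (2 * x * y * z + y * z) ⟩
    2 * x * y * z + y * z + (x + y) ≡⟨ +-assoc _ x y ⟨
    2 * x * y * z + y * z + x + y   ≡⟨ eq ⟨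
    n                               ∎
    where open ≤-Reasoning

  Solutionℕ-x<n : x < n
  Solutionℕ-x<n = ≤-trans (m<m+n x 1≤y) Solutionℕ-x+y≤n

  Solutionℕ-y≤n : y ≤ n
  Solutionℕ-y≤n = ≤-trans (m≤n+m y x) Solutionℕ-x+y≤n

  Solutionℕ-z≤n : z ≤ n
  Solutionℕ-z≤n = ≤-trans (m≤n*m z y {{>-nonZero 1≤y}}) (<⇒≤ Solutionℕ-yz<n)

  -- The equation read as division with remainder: `n - yz` has quotient `x` and remainder `y`
  -- modulo `2yz + 1`.
  Solutionℕ-remainder : n ≡ y + x * suc (2 * (y * z)) + y * z
  Solutionℕ-remainder = trans eq (rearrange x y z)
    where
    rearrange : ∀ x y z → 2 * x * y * z + y * z + x + y ≡ y + x * suc (2 * (y * z)) + y * z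
    rearrange = solve-∀

  -- The same equation read as a factorisation of `n - x`, with cofactor `y`.
  Solutionℕ-factor : n ≡ y * suc (z * (2 * x + 1)) + x
  Solutionℕ-factor = trans eq (rearrange x y z)
    where
    rearrange : ∀ x y z → 2 * x * y * z + y * z + x + y ≡ y * suc (z * (2 * x + 1)) + x
    rearrange = solve-∀

  Solutionℕ-y<2yz+1 : y < suc (2 * (y * z))
  Solutionℕ-y<2yz+1 = s≤s (≤-trans (m≤m*n y z {{>-nonZero 1≤z}}) (m≤n*m (y * z) 2))

-- Every coordinate is at most `n`, so the solutions can be filtered out of a finite box.
Solutionℕ-size : ∀ n → ∃[ k ] HasSize (Solutionℕ n) k
Solutionℕ-size n = _ , HasSize-cong
  (λ (x , y , z) → mk⇔ proj₂ λ s →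
    ∈-cartesianProduct⁺ (∈-upTo⁺ (s≤s (<⇒≤ (Solutionℕ-x<n x y z s))))
      (∈-cartesianProduct⁺ (∈-upTo⁺ (s≤s (Solutionℕ-y≤n x y z s)))
        (∈-upTo⁺ (s≤s (Solutionℕ-z≤n x y z s)))) , s)
  (HasSize-filter (solutionℕ? n)
    (cartesianProduct⁺ ns! (cartesianProduct⁺ ns! ns!)))
  where ns! = upTo⁺ (suc n)

-- Admissible numbers

product : ℕ × ℕ × ℕ → ℕ
product (x , y , z) = y * z

remainder-unique : ∀ {r r′ q q′ d} .{{_ : NonZero d}} → r < d → r′ < d →
                   r + q * d ≡ r′ + q′ * d → r ≡ r′
remainder-unique {r} {r′} {q} {q′} {d} r<d r′<d eq = begin
  r                  ≡⟨ m<n⇒m%n≡m r<d ⟨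
  r % d              ≡⟨ [m+kn]%n≡m%n r q d ⟨
  (r + q * d) % d    ≡⟨ cong (_% d) eq ⟩
  (r′ + q′ * d) % d  ≡⟨ [m+kn]%n≡m%n r′ q′ d ⟩
  r′ % d             ≡⟨ m<n⇒m%n≡m r′<d ⟩
  r′                 ∎
  where open ≡-Reasoning

-- Once `w = yz` is fixed, `y` is the remainder and `x` the quotient of `n - w` modulo `2w + 1`;
-- then `z` follows by cancelling `y` in `w`.
product-injective : ∀ n → InjectiveOn (Solutionℕ n) product
product-injective n {x , y , z} {x′ , y′ , z′} s s′ w≡w′ = same y≡y′ x≡x′ z≡z′
  where
  w = y * z
  eq : y + x * suc (2 * w) ≡ y′ + x′ * suc (2 * w)
  eq = +-cancelʳ-≡ w _ _ (begin
    y + x * suc (2 * w) + w                      ≡⟨ Solutionℕ-remainder x y z s ⟨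
    n                                            ≡⟨ Solutionℕ-remainder x′ y′ z′ s′ ⟩
    y′ + x′ * suc (2 * (y′ * z′)) + y′ * z′      ≡⟨ cong (λ v → y′ + x′ * suc (2 * v) + v) w≡w′ ⟨
    y′ + x′ * suc (2 * w) + w                    ∎)
    where open ≡-Reasoning
  y≡y′ : y ≡ y′
  y≡y′ = remainder-unique {q = x} {q′ = x′} (Solutionℕ-y<2yz+1 x y z s)
    (subst (λ v → y′ < suc (2 * v)) (sym w≡w′) (Solutionℕ-y<2yz+1 x′ y′ z′ s′)) eq
  x≡x′ : x ≡ x′
  x≡x′ = *-cancelʳ-≡ x x′ (suc (2 * w))
    (+-cancelˡ-≡ y _ _ (trans eq (cong (_+ x′ * suc (2 * w)) (sym y≡y′))))
  z≡z′ : z ≡ z′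
  z≡z′ = *-cancelˡ-≡ z z′ y {{>-nonZero (proj₁ s)}} (trans w≡w′ (cong (_* z′) (sym y≡y′)))
  same : y ≡ y′ → x ≡ x′ → z ≡ z′ → (x , y , z) ≡ (x′ , y′ , z′)
  same refl refl refl = refl

even⊎odd : ∀ q → ∃[ p ] (q ≡ 2 * p ⊎ q ≡ suc (2 * p))
even⊎odd zero    = 0 , inj₁ refl
even⊎odd (suc q) with even⊎odd q
... | p , inj₁ refl = p , inj₂ refl
... | p , inj₂ refl = suc p , inj₁ (sym (*-suc 2 p))

-- An even `q` would make the odd left side even.
odd-factor : ∀ q {m w} → suc (2 * m) ≡ q * suc (2 * w) → ∃[ p ] q ≡ suc (2 * p)
odd-factor q {m} {w} eq with even⊎odd q
... | p , inj₂ q≡   = p , q≡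
... | p , inj₁ refl =
  contradiction (sym (trans eq (*-assoc 2 p (suc (2 * w))))) (even≢odd (p * suc (2 * w)) m)

odd-difference : ∀ m h →
  + (2 * (m + h)) ℤ.- + (2 * h) ℤ.+ + 1 ≡ + suc (2 * m)
odd-difference m h = begin
  + (2 * (m + h)) ℤ.- + (2 * h) ℤ.+ + 1
    ≡⟨ cong (λ i → i ℤ.- + (2 * h) ℤ.+ + 1) (cong +_ (*-distribˡ-+ 2 m h)) ⟩
  + (2 * m) ℤ.+ + (2 * h) ℤ.- + (2 * h) ℤ.+ + 1
    ≡⟨ cancel (+ (2 * m)) (+ (2 * h)) ⟩
  + 1 ℤ.+ + (2 * m) ∎
  where
  open ≡-Reasoning
  cancel : ∀ i j → i ℤ.+ j ℤ.- j ℤ.+ + 1 ≡ + 1 ℤ.+ i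
  cancel = ℤ-Ring.solve-∀

-- When `h` is at most `n`, the integer `2n - 2h + 1` is the natural number `2m + 1` with
-- `m = n - h`, so the divisibility can be moved to ℕ.
Witness-divides⇔ : ∀ {n m h w} → m + h ≡ n →
  (+ (2 * w + 1) ∣ℤ (+ (2 * n) ℤ.- + (2 * h) ℤ.+ + 1)) ⇔ (suc (2 * w) ∣ suc (2 * m))
Witness-divides⇔ {m = m} {h} {w} refl
  rewrite odd-difference m h | +-comm (2 * w) 1 = mk⇔ ∣⇒∣ᵤ ∣ᵤ⇒∣

-- This links the divisibility to the equation: `2m + 1` is `2x + 1` times `2w + 1` exactly when
-- `m = x(2w + 1) + w`.
odd-product : ∀ x w → suc (2 * (x * suc (2 * w) + w)) ≡ suc (2 * x) * suc (2 * w)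
odd-product = solve-∀

Solutionℕ⇒Admissible : ∀ {n} t → Solutionℕ n t → Admissible n (product t)
Solutionℕ⇒Admissible {n} (x , y , z) s@(1≤y , _) =
  -- The witness is `h = y`, and the quotient in the second divisibility is `2x + 1`.
  y , 1≤y , divides z (*-comm y z) ,
  from (Witness-divides⇔ {n} {x * suc (2 * w) + w} {y} {w} m+y≡n)
    (divides (suc (2 * x)) (odd-product x w))
  where
  w = y * z
  rearrange : ∀ a b c → a + b + c ≡ c + a + b
  rearrange = solve-∀
  m+y≡n : x * suc (2 * w) + w + y ≡ n
  m+y≡n = trans (rearrange (x * suc (2 * w)) w y) (sym (Solutionℕ-remainder x y z s))

-- Since `w` is positive, `h ≤ w < n` and `n ∸ h` is a true difference. The quotient of
-- `2(n - h) + 1` by `2w + 1` is odd, and writing it as `2x + 1` yields the first coordinate.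
Admissible⇒Solutionℕ : ∀ {n w} → 1 ≤ w → w < n → Admissible n w →
                       Image product (Solutionℕ n) w
Admissible⇒Solutionℕ {n} {w} 1≤w w<n (h , 1≤h , h∣w@(divides z w≡zh) , d)
  with divides q eq ← to (Witness-divides⇔ {n} {n ∸ h} {h} {w} (m∸n+n≡m
         (≤-trans (∣⇒≤ {{>-nonZero 1≤w}} h∣w) (<⇒≤ w<n)))) d
  with x , refl ← odd-factor q {n ∸ h} {w} eq =
  (x , h , z) , (1≤h , 1≤z , n≡) , sym w≡hz
  where
  w≡hz : w ≡ h * z
  w≡hz = trans w≡zh (*-comm z h)
  1≤z : 1 ≤ z
  1≤z = n≢0⇒n>0 λ { refl → contradiction w≡zh (>⇒≢ 1≤w) }
  -- By `odd-product` both sides agree after doubling and adding one.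
  n∸h≡ : n ∸ h ≡ x * suc (2 * w) + w
  n∸h≡ = *-cancelˡ-≡ _ _ 2 (suc-injective (trans eq (sym (odd-product x w))))
  rearrange : ∀ x h z → x * suc (2 * (h * z)) + h * z + h ≡ 2 * x * h * z + h * z + x + h
  rearrange = solve-∀
  open ≡-Reasoning
  n≡ : n ≡ 2 * x * h * z + h * z + x + h
  n≡ = begin
    n                                          ≡⟨ m∸n+n≡m (≤-trans (∣⇒≤ {{>-nonZero 1≤w}} h∣w) (<⇒≤ w<n)) ⟨
    n ∸ h + h                                  ≡⟨ cong (_+ h) n∸h≡ ⟩
    x * suc (2 * w) + w + h                    ≡⟨ cong (λ v → x * suc (2 * v) + v + h) w≡hz ⟩
    x * suc (2 * (h * z)) + h * z + h          ≡⟨ rearrange x h z ⟩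
    2 * x * h * z + h * z + x + h              ∎

product≢0 : ∀ {n} t → Solutionℕ n t → ¬ product t ≡ 0
product≢0 (x , y , z) (1≤y , 1≤z , _) = >⇒≢ (*-mono-≤ 1≤y 1≤z)

a-size : ∀ n → HasSize (λ w → w < n × Admissible n w) (a n)
a-size n = HasSize-cong
  (λ w → mk⇔ (λ (w∈ , p) → ∈-upTo⁻ w∈ , p) (λ (w<n , p) → ∈-upTo⁺ w<n , p))
  (HasSize-filter (admissible? n) (upTo⁺ n))

-- For `x = 0` the modulus is 1, which divides every integer, so `h = 1` serves.
admissible-zero : ∀ n → Admissible n 0
admissible-zero n =
  1 , s≤s z≤n , divides 0 refl , ∣ᵤ⇒∣ (divides ℤ.∣ i ∣ (sym (*-identityʳ ℤ.∣ i ∣)))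
  where i = + (2 * n) ℤ.- + (2 * 1) ℤ.+ + 1

-- The summand 1 counts the admissible number 0, which lies in the range since `n` is positive; the
-- positive admissible numbers are the products `yz`.
a≡1+solutions : ∀ n → 1 ≤ n → HasSize (Solutionℕ n) k → a n ≡ 1 + k
a≡1+solutions n 1≤n hs = HasSize-unique (a-size n)
  (HasSize-cong (λ w → mk⇔
      (λ { (inj₁ refl)           → 1≤n , admissible-zero n
         ; (inj₂ (t@(x , y , z) , s , refl)) → Solutionℕ-yz<n x y z s , Solutionℕ⇒Admissible t s })
      (split w))
    (HasSize-⊎ (λ { refl (t , s , eq) → product≢0 t s eq })
      (HasSize-singleton 0) (HasSize-image product (product-injective n) hs)))
  where
  split : ∀ w → w < n × Admissible n w → w ≡ 0 ⊎ Image product (Solutionℕ n) w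
  split zero      _         = inj₁ refl
  split w@(suc _) (w<n , p) = inj₂ (Admissible⇒Solutionℕ (s≤s z≤n) w<n p)

-- Divisors

divisorPair : ℕ × ℕ × ℕ → ℕ × ℕ
divisorPair (x , y , z) = x , suc (z * (2 * x + 1))

-- The pair shows `x`; cancelling `2x + 1` in the divisor gives `z`, and cancelling the divisor in
-- `n - x` gives `y`.
divisorPair-injective : ∀ n → InjectiveOn (Solutionℕ n) divisorPair
divisorPair-injective n {x , y , z} {x′ , y′ , z′} s s′ eq
  with refl ← cong proj₁ eq
  with refl ← *-cancelʳ-≡ z z′ (2 * x + 1) {{>-nonZero (m≤n+m 1 (2 * x))}}
                (suc-injective (cong proj₂ eq))
  with refl ← *-cancelʳ-≡ y y′ (suc (z * (2 * x + 1))) (+-cancelʳ-≡ x _ _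
                (trans (sym (Solutionℕ-factor x y z s)) (Solutionℕ-factor x′ y′ z′ s′)))
  = refl

-- With the divisor in successor form, its integer difference with 1 computes to `+ e`.
DivisorOneMod-suc : ∀ m N e → 1 ≤ e → suc e ∣ N → m ∣ e → DivisorOneMod m N (suc e)
DivisorOneMod-suc m N e 1≤e d∣N m∣e = s≤s 1≤e , d∣N , ∣ᵤ⇒∣ m∣e

-- Phrased by membership in the lists that define the sum and `D`, so that `HasSize-Σ` and
-- `HasSize-filter` count it directly.
Pair : ℕ → ℕ × ℕ → Set
Pair n (j , d) = j ∈ upTo n × d ∈ upTo (suc (n ∸ j)) × DivisorOneMod (2 * j + 1) (n ∸ j) d

Solutionℕ⇒Pair : ∀ {n} t → Solutionℕ n t → Pair n (divisorPair t)
Solutionℕ⇒Pair {n} (x , y , z) s@(1≤y , 1≤z , _) =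
  -- Positivity of `n ∸ x` bounds its divisor and so places it in the range searched by `D`.
  ∈-upTo⁺ x<n , ∈-upTo⁺ (s≤s (∣⇒≤ {{>-nonZero (m<n⇒0<n∸m x<n)}} d∣)) ,
  DivisorOneMod-suc (2 * x + 1) (n ∸ x) (z * (2 * x + 1))
    (*-mono-≤ 1≤z (m≤n+m 1 (2 * x))) d∣ (divides z refl)
  where
  x<n = Solutionℕ-x<n x y z s
  d∣ : suc (z * (2 * x + 1)) ∣ n ∸ x
  d∣ = divides y (trans (cong (_∸ x) (Solutionℕ-factor x y z s)) (m+n∸n≡m _ x))

Pair⇒Solutionℕ : ∀ {n} p → Pair n p → Image divisorPair (Solutionℕ n) p
Pair⇒Solutionℕ {n} (j , suc e) (j∈ , _ , s≤s 1≤e , divides y n∸j≡ , m∣)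
  -- Here `y` is the cofactor of the divisor in `n ∸ j`, and `z` is the quotient of `e` by `2j + 1`.
  with divides z refl ← ∣⇒∣ᵤ m∣ =
  (j , y , z) , (1≤y , 1≤z , n≡) , refl
  where
  j<n = ∈-upTo⁻ j∈
  1≤y : 1 ≤ y
  1≤y = n≢0⇒n>0 λ { refl → contradiction n∸j≡ (>⇒≢ (m<n⇒0<n∸m j<n)) }
  -- If `z` were 0, the divisor would be 1, which `D` excludes.
  1≤z : 1 ≤ z
  1≤z = n≢0⇒n>0 λ { refl → contradiction 1≤e λ () }
  rearrange : ∀ j y z → y * suc (z * (2 * j + 1)) + j ≡ 2 * j * y * z + y * z + j + y
  rearrange = solve-∀
  n≡ : n ≡ 2 * j * y * z + y * z + j + y
  n≡ = trans (sym (m∸n+n≡m (<⇒≤ j<n))) (trans (cong (_+ j) n∸j≡) (rearrange j y z))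

solutions≡ΣD : ∀ n → HasSize (Solutionℕ n) k → k ≡ Σ[ j < n ] D (2 * j + 1) (n ∸ j)
solutions≡ΣD n hs = HasSize-unique
  (HasSize-cong {Q = Pair n}
    (λ p → mk⇔ (λ { (t , s , refl) → Solutionℕ⇒Pair t s }) (Pair⇒Solutionℕ p))
    (HasSize-image divisorPair (divisorPair-injective n) hs))
  (HasSize-Σ
    (λ j → HasSize-filter (divisorOneMod? (2 * j + 1) (n ∸ j)) (upTo⁺ (suc (n ∸ j))))
    (upTo⁺ n))

theorem11 : ∀ (n : ℕ) → 1 ≤ n →
    (∃[ k ] (HasSize (Solution n) k × a n ≡ 1 + k)) ×
    (a n ≡ 1 + (Σ[ j < n ] D (2 * j + 1) (n ∸ j)))
theorem11 n 1≤n with k , hs ← Solutionℕ-size n =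
  (k ,
   HasSize-cong (Solution⇔ n) (HasSize-image toℤ³ (λ { _ _ refl → refl }) hs) ,
   a≡1+solutions n 1≤n hs) ,
  trans (a≡1+solutions n 1≤n hs) (cong suc (solutions≡ΣD n hs))
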